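{- Let $F$ be a field of characteristic $p>0$. Let $X=\{\mathfrak D_{i_j}\}_{j=0}^\infty$ be a null sequence of divided elements, let $E=\{e_j(x)\}_{j=0}^\infty$ be a sequence of additive polynomials in $F[x]$, and define $$f_{X,E}(x)=1+\sum_j e_j(x)\mathfrak D_{i_j}\,.$$ Then the element $f_{X,E}(x)$ lies in $\mathfrak{BD}^\ast$.
   Context: $F[x]\{\{\mathfrak D\}\}$ is the commutative ring of formal series $\sum_{i\ge0}a_i\mathfrak D_i$ ($a_i\in F[x]$) with coefficientwise addition and multiplication determined by $\mathfrak D_i\cdot\mathfrak D_j=\binom{i+j}{j}\mathfrak D_{i+j}$; its unit is $\mathfrak D_0=1$. The symbols $\mathfrak D_i$ are called divided elements. A sequence $\{\mathfrak D_{i_j}\}_{j=0}^\infty$ of divided elements is a null sequence if and only if $\mathfrak D_{i_j}\cdot\mathfrak D_{i_t}=0$ for all $j$ and $t$ (where $j=t$ is permitted). A polynomial $f(x)\in F[x]$ is additive if $f(x+y)=f(x)+f(y)$ for all $x,y$ in the algebraic closure of $F$, equivalently if it contains only monomials of the form $cx^{p^n}$. A sequence $P=\{p_i(x)\}_{i=0}^\infty$ in $F[x]$ satisfies the Binomial Theorem if $p_n(x+y)=\sum_{i=0}^n\binom ni p_i(x)p_{n-i}(y)$ for all $n\ge0$; it is nontrivial if not all $p_i(x)$ are zero. $\mathfrak{BD}^\ast$ is the set of all generating functions $\sum_{i\ge0}p_i(x)\mathfrak D_i\in F[x]\{\{\mathfrak D\}\}$ of nontrivial sequences $P$ satisfying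 the Binomial Theorem. -}

module Defs where

open import Level using (Level; _⊔_) renaming (suc to lsuc)
open import Data.Nat.Base using (ℕ; zero; suc; _≤_; _<_; _∸_)
open import Data.Nat.Properties using (_≟_)
open import Data.Nat.Combinatorics using (_C_)
open import Data.Nat.Divisibility using (_∣_)
open import Data.Fin.Base using (toℕ)
open import Data.List.Base using (List; []; _∷_; map)
open import Data.Product.Base using (∃-syntax; _×_; proj₁)
open import Function.Base using (_∘_; id)
open import Function.Bundles using (_⇔_)
open import Relation.Nullary.Negation using (¬_)
open import Relation.Nullary.Decidable using (yes; no)
open import Algebra.Bundles using (CommutativeRing)
open import Algebra.Bundles.Raw using (RawRing)
open import Algebra.Apartness.Bundles using (HeytingCommutativeRing; HeytingField)
open import Algebra.Morphism.Structures using (module RingMorphisms)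
import Algebra.Definitions.RawMonoid as RawMonoidDefs

fieldRing : ∀ {c ℓ₁ ℓ₂} → HeytingField c ℓ₁ ℓ₂ → RawRing c ℓ₁
fieldRing F = CommutativeRing.rawRing
  (HeytingCommutativeRing.commutativeRing (HeytingField.heytingCommutativeRing F))

module RingOps {c ℓ} (R : RawRing c ℓ) where
  open RawMonoidDefs (RawRing.+-rawMonoid R) public
    using (sum) renaming (_×_ to _×ᴿ_)

HasCharacteristic : ∀ {c ℓ} → RawRing c ℓ → ℕ → Set ℓ
HasCharacteristic R p = ∀ n → (n ×ᴿ 1# ≈ 0#) ⇔ p ∣ n
  where
  open RawRing R
  open RingOps R

-- A polynomial is its list of coefficients, constant term first.  Trailing
-- zeros are allowed, so polynomials are compared coefficient by coefficient.
module Polynomials {c ℓ} (R : RawRing c ℓ) where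
  open RawRing R

  Poly : Set c
  Poly = List Carrier

  coeff : Poly → ℕ → Carrier
  coeff []      _       = 0#
  coeff (a ∷ f) zero    = a
  coeff (a ∷ f) (suc n) = coeff f n

  infixl 6 _+ₚ_
  infixl 7 _*ₚ_

  _+ₚ_ : Poly → Poly → Poly
  []      +ₚ g       = g
  (a ∷ f) +ₚ []      = a ∷ f
  (a ∷ f) +ₚ (b ∷ g) = (a + b) ∷ (f +ₚ g)

  _*ₚ_ : Poly → Poly → Poly
  []      *ₚ g = []
  (a ∷ f) *ₚ g = map (a *_) g +ₚ (0# ∷ (f *ₚ g))

  polynomialRing : RawRing c ℓ
  polynomialRing = record
    { Carrier = Poly
    ; _≈_     = λ f g → ∀ n → coeff f n ≈ coeff g n
    ; _+_     = _+ₚ_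
    ; _*_     = _*ₚ_
    ; -_      = map (-_)
    ; 0#      = []
    ; 1#      = 1# ∷ []
    }

  const : Carrier → Poly
  const a = a ∷ []

  X : Poly
  X = 0# ∷ 1# ∷ []

  -- The value f(s) in a ring S into which the coefficients are mapped by φ.
  evalIn : ∀ {c′ ℓ′} (S : RawRing c′ ℓ′) → (Carrier → RawRing.Carrier S) →
           Poly → RawRing.Carrier S → RawRing.Carrier S
  evalIn S φ []      s = RawRing.0# S
  evalIn S φ (a ∷ f) s = φ a S.+ (s S.* evalIn S φ f s)
    where module S = RawRing S

infix 30 _[X]

_[X] : ∀ {c ℓ} → RawRing c ℓ → RawRing c ℓ
R [X] = Polynomials.polynomialRing R

-- A series ∑ᵢ aᵢ 𝔇ᵢ is its sequence of coefficients.
module DividedSeries {c ℓ} (R : RawRing c ℓ) where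
  open RawRing R
  open RingOps R

  Series : Set c
  Series = ℕ → Carrier

  𝔇 : ℕ → Series
  𝔇 i n with i ≟ n
  ... | yes _ = 1#
  ... | no  _ = 0#

  -- The product is the bilinear (and infinitely additive) extension of
  -- 𝔇ᵢ 𝔇ⱼ = C(i + j, j) 𝔇ᵢ₊ⱼ.
  seriesRing : RawRing c ℓ
  seriesRing = record
    { Carrier = Series
    ; _≈_     = λ a b → ∀ n → a n ≈ b n
    ; _+_     = λ a b n → a n + b n
    ; _*_     = λ a b n → sum {suc n} λ k →
                  (n C toℕ k) ×ᴿ (a (toℕ k) * b (n ∸ toℕ k))
    ; -_      = λ a n → - a n
    ; 0#      = λ _ → 0#
    ; 1#      = 𝔇 0
    }

  infixr 7 _•_

  _•_ : Carrier → Series → Series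
  (r • a) n = r * a n

  -- An infinite sum of series makes sense when each coefficient receives only
  -- finitely many nonzero contributions.  For aⱼ = rⱼ • 𝔇 (i j) this holds
  -- whenever every index occurs finitely often in i, in particular when the
  -- 𝔇 (i j) are pairwise distinct.
  Summable : (ℕ → Series) → Set ℓ
  Summable a = ∀ n → ∃[ N ] (∀ j → N ≤ j → a j n ≈ 0#)

  ∑ : (a : ℕ → Series) → Summable a → Series
  ∑ a summable n = sum {proj₁ (summable n)} λ j → a (toℕ j) n

  𝔣 : (i : ℕ → ℕ) (e : ℕ → Carrier) → Summable (λ j → e j • 𝔇 (i j)) → Series
  𝔣 i e summable = 1ₛ ⊕ ∑ (λ j → e j • 𝔇 (i j)) summable
    where open RawRing seriesRing using () renaming (_+_ to _⊕_; 1# to 1ₛ)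

  NullSequence : (ℕ → ℕ) → Set ℓ
  NullSequence i = ∀ j t → 𝔇 (i j) ⊛ 𝔇 (i t) ≋ 0ₛ
    where open RawRing seriesRing using () renaming (_*_ to _⊛_; _≈_ to _≋_; 0# to 0ₛ)

module _ {c ℓ₁ ℓ₂} (F : HeytingField c ℓ₁ ℓ₂) where
  open HeytingField F
  open Polynomials (fieldRing F) using (Poly; coeff; evalIn)

  NonzeroPoly : Poly → Set ℓ₂
  NonzeroPoly f = ∃[ n ] coeff f n # 0#

  HasDegree : Poly → ℕ → Set (ℓ₁ ⊔ ℓ₂)
  HasDegree f n = coeff f n # 0# × (∀ m → n < m → coeff f m ≈ 0#)

  AlgebraicallyClosed : Set (c ⊔ ℓ₁ ⊔ ℓ₂)
  AlgebraicallyClosed = ∀ f n → HasDegree f (suc n) →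
    ∃[ a ] evalIn (fieldRing F) id f a ≈ 0#

record AlgebraicClosure {c ℓ₁ ℓ₂} (F : HeytingField c ℓ₁ ℓ₂) (c′ ℓ₁′ ℓ₂′ : Level)
       : Set (c ⊔ ℓ₁ ⊔ ℓ₂ ⊔ lsuc (c′ ⊔ ℓ₁′ ⊔ ℓ₂′)) where
  private module F = HeytingField F
  open Polynomials (fieldRing F) using (evalIn)
  open RingMorphisms using (IsRingMonomorphism)
  field
    closure : HeytingField c′ ℓ₁′ ℓ₂′
  open HeytingField closure using (Carrier; _≈_; 0#)
  field
    embed               : F.Carrier → Carrier
    isRingMonomorphism  : IsRingMonomorphism (fieldRing F) (fieldRing closure) embed
    algebraic           : ∀ a → ∃[ f ] NonzeroPoly F f ×
                            evalIn (fieldRing closure) embed f a ≈ 0#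
    algebraicallyClosed : AlgebraicallyClosed closure

module _ {c ℓ₁ ℓ₂ c′ ℓ₁′ ℓ₂′} {F : HeytingField c ℓ₁ ℓ₂}
         (F̄ : AlgebraicClosure F c′ ℓ₁′ ℓ₂′) where
  open AlgebraicClosure F̄ using (closure; embed)
  open HeytingField closure using (_≈_; _+_)
  open Polynomials (fieldRing F) using (Poly; evalIn)

  Additive : Poly → Set (c′ ⊔ ℓ₁′)
  Additive f = ∀ x y → ⟦ f ⟧ (x + y) ≈ ⟦ f ⟧ x + ⟦ f ⟧ y
    where ⟦_⟧ = evalIn (fieldRing closure) embed

module Binomial {c ℓ} (R : RawRing c ℓ) where
  open Polynomials R using (Poly; evalIn)
  open DividedSeries (R [X]) using (Series)

  -- R[x, y] is R[x][y].
  private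
    R[x,y] = R [X] [X]
    module R[x] = Polynomials R
    module R[x][y] = Polynomials (R [X])
  open RawRing R[x,y]
  open RingOps R[x,y]

  SatisfiesBinomialTheorem : (ℕ → Poly) → Set ℓ
  SatisfiesBinomialTheorem p = ∀ n →
    p n ⟨ x + y ⟩ ≈ sum {suc n} λ i →
      (n C toℕ i) ×ᴿ (p (toℕ i) ⟨ x ⟩ * p (n ∸ toℕ i) ⟨ y ⟩)
    where
    x y : Carrier
    x = R[x][y].const R[x].X
    y = R[x][y].X
    _⟨_⟩ : Poly → Carrier → Carrier
    _⟨_⟩ = evalIn R[x,y] (R[x][y].const ∘ R[x].const)

  Nontrivial : (ℕ → Poly) → Set ℓ
  Nontrivial p = ¬ (∀ i → RawRing._≈_ (R [X]) (p i) (RawRing.0# (R [X])))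

  -- The generating function ∑ᵢ pᵢ 𝔇ᵢ is the series with coefficients pᵢ.
  generatingFunction : (ℕ → Poly) → Series
  generatingFunction p = p

  𝔅𝔇* : Series → Set (c ⊔ ℓ)
  𝔅𝔇* f = ∃[ p ] SatisfiesBinomialTheorem p × Nontrivial p ×
            f ≋ generatingFunction p
    where open RawRing (DividedSeries.seriesRing (R [X])) using () renaming (_≈_ to _≋_)

{-# OPTIONS --safe #-}

-- Write p₀, p₁, … for the coefficients of f = 1 + ∑ⱼ eⱼ 𝔇 (i j).  For n ≥ 1 the
-- polynomial pₙ is a sum of the additive eⱼ with i j = n, hence additive, and
-- p₀ = 1 because 𝔇₀² = 1 ≠ 0 keeps 0 out of a null sequence.  In the binomial
-- sum for pₙ (x + y) the two end terms give pₙ (x) + pₙ (y), and a middle term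
-- C(n, k) pₖ (x) pₙ₋ₖ (y) vanishes: either no i j equals k, or no i t equals
-- n − k, or C(n, k) is the coefficient of 𝔇 (i j) 𝔇 (i t) = 0.
--
-- All of this is checked on values in the algebraic closure.  Values determine
-- the coefficients of a bivariate polynomial because the closure has arbitrarily
-- many pairwise apart elements: a root of 1 + ∏ₖ (x − aₖ) is apart from every aₖ.
module Submission where

open import Defs
open import Level using (_⊔_)
open import Data.Nat.Base using (ℕ; zero; suc; _<_; _≤_; _∸_; s≤s; s<s; z≤n)
  renaming (_+_ to _+ℕ_)
import Data.Nat.Properties as ℕ
open import Data.Nat.Combinatorics using (_C_; nCn≡1; nCk≡nC[n∸k])
open import Data.Fin.Base using (Fin; zero; suc; toℕ; fromℕ; inject₁; fromℕ<)
import Data.Fin.Properties as Fin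
open import Data.List.Base using (List; []; _∷_; map; length)
open import Data.List.Relation.Unary.All as All using (All; []; _∷_)
open import Data.List.Relation.Unary.AllPairs using (AllPairs; []; _∷_)
open import Data.Product.Base using (∃-syntax; _×_; _,_; proj₁; proj₂)
open import Data.Sum.Base using (_⊎_; inj₁; inj₂)
open import Data.Vec.Functional using (Vector; removeAt; tail; init)
open import Function.Base using (_∘_; id)
open import Relation.Nullary.Negation using (¬_; contradiction)
open import Relation.Nullary.Decidable using (yes; no)
open import Relation.Binary.PropositionalEquality as ≡ using (_≡_; _≢_)
import Relation.Binary.Reasoning.Setoid as SetoidReasoning
open import Algebra.Bundles using (CommutativeRing)
open import Algebra.Bundles.Raw using (RawRing)
open import Algebra.Apartness.Bundles using (HeytingCommutativeRing; HeytingField)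
open import Algebra.Morphism.Structures using (module RingMorphisms)
import Algebra.Properties.Ring as RingProperties
import Algebra.Properties.Semiring.Sum as SemiringSum
import Algebra.Properties.Semiring.Mult as SemiringMult
import Algebra.Apartness.Properties.HeytingCommutativeRing as HeytingProperties
import Algebra.Solver.Ring.NaturalCoefficients.Default as NatSolver

open RingMorphisms using (IsRingHomomorphism; IsRingMonomorphism)

commutativeRing : ∀ {c ℓ₁ ℓ₂} → HeytingField c ℓ₁ ℓ₂ → CommutativeRing c ℓ₁
commutativeRing F =
  HeytingCommutativeRing.commutativeRing (HeytingField.heytingCommutativeRing F)

nC0≡1 : ∀ n → n C 0 ≡ 1
nC0≡1 n = ≡.trans (nCk≡nC[n∸k] {0} {n} z≤n) (nCn≡1 n)

-- Coefficients of divided elements and finite sums.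

module DividedElements {c ℓ} (R : RawRing c ℓ) where
  open RawRing R
  open DividedSeries R

  𝔇-diagonal : ∀ n → 𝔇 n n ≡ 1#
  𝔇-diagonal n with n ℕ.≟ n
  ... | yes _  = ≡.refl
  ... | no n≢n = contradiction ≡.refl n≢n

  𝔇-offDiagonal : ∀ {i n} → i ≢ n → 𝔇 i n ≡ 0#
  𝔇-offDiagonal {i} {n} i≢n with i ℕ.≟ n
  ... | yes i≡n = contradiction i≡n i≢n
  ... | no _    = ≡.refl

module SumProperties {c ℓ} (S : CommutativeRing c ℓ) where
  open CommutativeRing S hiding (zero)
  open SemiringSum semiring public
  open SetoidReasoning setoid

  sum-zero : ∀ {n} {t : Vector Carrier n} → (∀ k → t k ≈ 0#) → sum t ≈ 0#
  sum-zero {n} t≈0 = trans (sum-cong-≋ t≈0) (sum-replicate-zero n)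

  sum-single : ∀ {n} (t : Vector Carrier n) k → (∀ l → l ≢ k → t l ≈ 0#) →
               sum t ≈ t k
  sum-single {suc n} t k t≈0 = begin
    sum t                     ≈⟨ sum-remove {i = k} t ⟩
    t k + sum (removeAt t k)  ≈⟨ +-congˡ (sum-zero λ l → t≈0 _ (Fin.punchInᵢ≢i k l)) ⟩
    t k + 0#                  ≈⟨ +-identityʳ _ ⟩
    t k                       ∎

  -- Isolates the two end terms of a binomial sum. The middle indices have the form
  -- `suc (inject₁ k)` because the head is split off first and then the last entry of the tail.
  sum-ends : ∀ {n} (t : Vector Carrier (suc (suc n))) →
             (∀ (k : Fin n) → t (suc (inject₁ k)) ≈ 0#) →
             sum t ≈ t zero + t (suc (fromℕ n))
  sum-ends {n} t t≈0 = +-congˡ (begin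
    sum (tail t)                                ≈⟨ sum-init-last (tail t) ⟩
    sum (init (tail t)) + t (suc (fromℕ n))     ≈⟨ +-congʳ (sum-zero t≈0) ⟩
    0# + t (suc (fromℕ n))                      ≈⟨ +-identityˡ _ ⟩
    t (suc (fromℕ n))                           ∎)

-- Homomorphisms on sums, multiples and polynomial values.

module HomomorphismProperties
  {a ℓ c ℓ′} (R : RawRing a ℓ) (S : CommutativeRing c ℓ′)
  {φ : RawRing.Carrier R → CommutativeRing.Carrier S}
  (φ-homo : IsRingHomomorphism R (CommutativeRing.rawRing S) φ) where

  private
    module R = RawRing R
    module ΣR = RingOps R
  open CommutativeRing S hiding (zero)
  open IsRingHomomorphism φ-homo
  open SemiringSum semiring using (sum)
  open SemiringMult semiring using () renaming (_×_ to _×ˢ_)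

  sum-homo : ∀ {n} (t : Vector R.Carrier n) → φ (ΣR.sum t) ≈ sum (φ ∘ t)
  sum-homo {zero}  t = 0#-homo
  sum-homo {suc n} t = trans (+-homo _ _) (+-congˡ (sum-homo (tail t)))

  ×-homo : ∀ n x → φ (n ΣR.×ᴿ x) ≈ n ×ˢ φ x
  ×-homo zero    x = 0#-homo
  ×-homo (suc n) x = trans (+-homo _ _) (+-congˡ (×-homo n x))

  open Polynomials using (evalIn)

  -- The coefficients lie in a third structure `Q`, and `φ ∘ χ` need only agree pointwise with `ψ`.
  -- This covers a polynomial over `F` whose argument lies in `F[x][y]`.
  evalIn-homo : ∀ {b ℓ″} (Q : RawRing b ℓ″) {χ : RawRing.Carrier Q → R.Carrier}
                {ψ : RawRing.Carrier Q → Carrier} → (∀ q → φ (χ q) ≈ ψ q) →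
                ∀ f {s t} → φ s ≈ t → φ (evalIn Q R χ f s) ≈ evalIn Q rawRing ψ f t
  evalIn-homo Q φχ≈ψ []      φs≈t = 0#-homo
  evalIn-homo Q φχ≈ψ (q ∷ f) φs≈t =
    trans (+-homo _ _) (+-cong (φχ≈ψ q)
      (trans (*-homo _ _) (*-cong φs≈t (evalIn-homo Q φχ≈ψ f φs≈t))))

-- Evaluation as a ring homomorphism.

module Evaluation
  {a ℓ c ℓ′} (R : RawRing a ℓ) (S : CommutativeRing c ℓ′)
  {φ : RawRing.Carrier R → CommutativeRing.Carrier S}
  (φ-homo : IsRingHomomorphism R (CommutativeRing.rawRing S) φ) where

  private
    module R = RawRing R
  open CommutativeRing S hiding (zero)
  open IsRingHomomorphism φ-homo
  open Polynomials R
  open SetoidReasoning setoid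
  open RingProperties ring using (-0#≈0#; -‿+-comm; -‿distribʳ-*)
  open NatSolver commutativeSemiring using (solve; _:=_; _:+_; _:*_)

  eval : Poly → Carrier → Carrier
  eval = evalIn rawRing φ

  eval-const : ∀ a s → eval (const a) s ≈ φ a
  eval-const a s = trans (+-congˡ (zeroʳ s)) (+-identityʳ (φ a))

  eval-X : ∀ s → eval X s ≈ s
  eval-X s = begin
    φ R.0# + s * eval (const R.1#) s  ≈⟨ +-cong 0#-homo (*-congˡ (eval-const R.1# s)) ⟩
    0# + s * φ R.1#                   ≈⟨ +-identityˡ _ ⟩
    s * φ R.1#                        ≈⟨ *-congˡ 1#-homo ⟩
    s * 1#                            ≈⟨ *-identityʳ s ⟩
    s                                 ∎

  -- `R` is a raw ring, so a law such as `0# + a ≈ a` is available only for images under `φ`; hence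
  -- the comparison in `S`. In this way `R` may itself be a polynomial ring.
  coeff-+ : ∀ f g n → φ (coeff (f +ₚ g) n) ≈ φ (coeff f n) + φ (coeff g n)
  coeff-+ []      g       n       = sym (trans (+-congʳ 0#-homo) (+-identityˡ _))
  coeff-+ (a ∷ f) []      n       = sym (trans (+-congˡ 0#-homo) (+-identityʳ _))
  coeff-+ (a ∷ f) (b ∷ g) zero    = +-homo a b
  coeff-+ (a ∷ f) (b ∷ g) (suc n) = coeff-+ f g n

  coeff-scale : ∀ a f n → φ (coeff (map (a R.*_) f) n) ≈ φ a * φ (coeff f n)
  coeff-scale a []      n       = trans 0#-homo (sym (trans (*-congˡ 0#-homo) (zeroʳ _)))
  coeff-scale a (b ∷ f) zero    = *-homo a b
  coeff-scale a (b ∷ f) (suc n) = coeff-scale a f n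

  coeff-neg : ∀ f n → φ (coeff (map R.-_ f) n) ≈ - φ (coeff f n)
  coeff-neg []      n       = trans 0#-homo (sym (trans (-‿cong 0#-homo) -0#≈0#))
  coeff-neg (a ∷ f) zero    = -‿homo a
  coeff-neg (a ∷ f) (suc n) = coeff-neg f n

  module _ (s : Carrier) where

    eval-zero : ∀ f → (∀ n → φ (coeff f n) ≈ 0#) → eval f s ≈ 0#
    eval-zero []      f≈0 = refl
    eval-zero (a ∷ f) f≈0 = begin
      φ a + s * eval f s  ≈⟨ +-cong (f≈0 0) (*-congˡ (eval-zero f (f≈0 ∘ suc))) ⟩
      0# + s * 0#         ≈⟨ +-identityˡ _ ⟩
      s * 0#              ≈⟨ zeroʳ s ⟩
      0#                  ∎

    -- Lists of different lengths can represent the same polynomial. Where one list ends, `φ` sends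
    -- all remaining coefficients of the other to zero.
    eval-cong : ∀ f g → (∀ n → coeff f n R.≈ coeff g n) → eval f s ≈ eval g s
    eval-cong []      g       f≈g =
      sym (eval-zero g λ n → trans (sym (⟦⟧-cong (f≈g n))) 0#-homo)
    eval-cong (a ∷ f) []      f≈g =
      eval-zero (a ∷ f) λ n → trans (⟦⟧-cong (f≈g n)) 0#-homo
    eval-cong (a ∷ f) (b ∷ g) f≈g =
      +-cong (⟦⟧-cong (f≈g 0)) (*-congˡ (eval-cong f g (f≈g ∘ suc)))

    eval-+ : ∀ f g → eval (f +ₚ g) s ≈ eval f s + eval g s
    eval-+ []      g       = sym (+-identityˡ _)
    eval-+ (a ∷ f) []      = sym (+-identityʳ _)
    eval-+ (a ∷ f) (b ∷ g) = begin
      φ (a R.+ b) + s * eval (f +ₚ g) s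
        ≈⟨ +-cong (+-homo a b) (*-congˡ (eval-+ f g)) ⟩
      (φ a + φ b) + s * (eval f s + eval g s)
        ≈⟨ solve 5 (λ a b s f g → (a :+ b) :+ s :* (f :+ g)
             := (a :+ s :* f) :+ (b :+ s :* g)) refl _ _ _ _ _ ⟩
      (φ a + s * eval f s) + (φ b + s * eval g s) ∎

    eval-scale : ∀ a f → eval (map (a R.*_) f) s ≈ φ a * eval f s
    eval-scale a []      = sym (zeroʳ _)
    eval-scale a (b ∷ f) = begin
      φ (a R.* b) + s * eval (map (a R.*_) f) s
        ≈⟨ +-cong (*-homo a b) (*-congˡ (eval-scale a f)) ⟩
      φ a * φ b + s * (φ a * eval f s)
        ≈⟨ solve 4 (λ a b s f → a :* b :+ s :* (a :* f) := a :* (b :+ s :* f))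
             refl _ _ _ _ ⟩
      φ a * (φ b + s * eval f s) ∎

    eval-* : ∀ f g → eval (f *ₚ g) s ≈ eval f s * eval g s
    eval-* []      g = sym (zeroˡ _)
    eval-* (a ∷ f) g = begin
      eval (map (a R.*_) g +ₚ (R.0# ∷ (f *ₚ g))) s
        ≈⟨ eval-+ (map (a R.*_) g) (R.0# ∷ (f *ₚ g)) ⟩
      eval (map (a R.*_) g) s + (φ R.0# + s * eval (f *ₚ g) s)
        ≈⟨ +-cong (eval-scale a g)
             (trans (+-congʳ 0#-homo) (trans (+-identityˡ _) (*-congˡ (eval-* f g)))) ⟩
      φ a * eval g s + s * (eval f s * eval g s)
        ≈⟨ solve 4 (λ a g s f → a :* g :+ s :* (f :* g) := (a :+ s :* f) :* g)
             refl _ _ _ _ ⟩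
      (φ a + s * eval f s) * eval g s ∎

    eval-neg : ∀ f → eval (map R.-_ f) s ≈ - eval f s
    eval-neg []      = sym -0#≈0#
    eval-neg (a ∷ f) = begin
      φ (R.- a) + s * eval (map R.-_ f) s  ≈⟨ +-cong (-‿homo a) (*-congˡ (eval-neg f)) ⟩
      - φ a + s * - eval f s               ≈⟨ +-congˡ (-‿distribʳ-* s _) ⟨
      - φ a + - (s * eval f s)             ≈⟨ -‿+-comm _ _ ⟩
      - (φ a + s * eval f s)               ∎

    eval-isRingHomomorphism : IsRingHomomorphism (R [X]) rawRing (λ f → eval f s)
    eval-isRingHomomorphism = record
      { isSemiringHomomorphism = record
        { isNearSemiringHomomorphism = record
          { +-isMonoidHomomorphism = record
            { isMagmaHomomorphism = record
              { isRelHomomorphism = record { cong = λ {f} {g} → eval-cong f g }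
              ; homo = eval-+
              }
            ; ε-homo = refl
            }
          ; *-homo = eval-*
          }
        ; 1#-homo = trans (eval-const R.1# s) 1#-homo
        }
      ; -‿homo = eval-neg
      }

-- Roots of polynomials over a Heyting field.

module HeytingFieldPolynomials {c ℓ₁ ℓ₂} (K : HeytingField c ℓ₁ ℓ₂) where
  open HeytingField K using (_#_; #⇒invertible; #-sym)
  open CommutativeRing (commutativeRing K) hiding (zero)
  open HeytingProperties (HeytingField.heytingCommutativeRing K)
    using (1#0; invertibleˡ⇒#; #-congʳ)
  open RingProperties ring using (x∙y⁻¹≈ε⇒x≈y)
  open SetoidReasoning setoid
  open Polynomials rawRing using (Poly; coeff; evalIn; const; _+ₚ_; _*ₚ_)
  open NatSolver commutativeSemiring using (solve; _:=_; _:+_; _:*_)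

  private
    id-isRingHomomorphism : IsRingHomomorphism rawRing rawRing id
    id-isRingHomomorphism = record
      { isSemiringHomomorphism = record
        { isNearSemiringHomomorphism = record
          { +-isMonoidHomomorphism = record
            { isMagmaHomomorphism = record
              { isRelHomomorphism = record { cong = id }
              ; homo = λ _ _ → refl
              }
            ; ε-homo = refl
            }
          ; *-homo = λ _ _ → refl
          }
        ; 1#-homo = refl
        }
      ; -‿homo = λ _ → refl
      }

  open Evaluation rawRing (commutativeRing K) id-isRingHomomorphism

  a+[x-a]≈x : ∀ a x → a + (x - a) ≈ x
  a+[x-a]≈x a x = begin
    a + (x - a)    ≈⟨ solve 3 (λ a x b → a :+ (x :+ b) := x :+ (a :+ b)) refl a x (- a) ⟩
    x + (a - a)    ≈⟨ +-congˡ (-‿inverseʳ a) ⟩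
    x + 0#         ≈⟨ +-identityʳ x ⟩
    x              ∎

  -- (f(x) − f(a)) / (x − a) for f = c ∷ g; it does not depend on c.
  quotient : Carrier → Poly → Poly
  quotient a []      = []
  quotient a (d ∷ g) = eval (d ∷ g) a ∷ quotient a g

  length-quotient : ∀ a g → length (quotient a g) ≡ length g
  length-quotient a []      = ≡.refl
  length-quotient a (d ∷ g) = ≡.cong suc (length-quotient a g)

  -- Division with remainder by `x - a`. After the induction hypothesis the factor `x` in front of
  -- the remainder `w` is split as `a + (x - a)`: the part `a * w` completes the value at `a`, and
  -- `w` becomes the constant term of the new quotient.
  eval-quotient : ∀ a x c g →
    eval (c ∷ g) x ≈ eval (c ∷ g) a + (x - a) * eval (quotient a g) x
  eval-quotient a x c [] = begin
    c + x * 0#                   ≈⟨ +-congˡ (zeroʳ x) ⟩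
    c + 0#                       ≈⟨ +-congˡ (zeroʳ a) ⟨
    c + a * 0#                   ≈⟨ +-identityʳ _ ⟨
    c + a * 0# + 0#              ≈⟨ +-congˡ (zeroʳ _) ⟨
    c + a * 0# + (x - a) * 0#    ∎
  eval-quotient a x c (d ∷ g) = begin
    c + x * eval (d ∷ g) x
      ≈⟨ +-congˡ (*-congˡ (eval-quotient a x d g)) ⟩
    c + x * (w + s * q)
      ≈⟨ +-congˡ (trans (distribˡ x w _) (+-congʳ (*-congʳ (sym (a+[x-a]≈x a x))))) ⟩
    c + ((a + s) * w + x * (s * q))
      ≈⟨ solve 6 (λ c a s w x q → c :+ ((a :+ s) :* w :+ x :* (s :* q))
           := (c :+ a :* w) :+ s :* (w :+ x :* q)) refl c a s w x q ⟩
    (c + a * w) + s * (w + x * q) ∎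
    where
    s = x - a
    w = eval (d ∷ g) a
    q = eval (quotient a g) x

  invertible-cancelˡ : ∀ {x y z} → x # y → (x - y) * z ≈ 0# → z ≈ 0#
  invertible-cancelˡ {x} {y} {z} x#y xyz≈0 with #⇒invertible x#y
  ... | u , u[x-y]≈1 , _ = begin
    z                    ≈⟨ *-identityˡ z ⟨
    1# * z               ≈⟨ *-congʳ u[x-y]≈1 ⟨
    (u * (x - y)) * z    ≈⟨ *-assoc u _ z ⟩
    u * ((x - y) * z)    ≈⟨ *-congˡ xyz≈0 ⟩
    u * 0#               ≈⟨ zeroʳ u ⟩
    0#                   ∎

  Zeros : Poly → Set (c ⊔ ℓ₁)
  Zeros = All (_≈ 0#)

  -- The entries of `quotient a g` are the Horner values at `a` of the successive nonempty tails of
  -- `g`. Each coefficient of `g` is one such value minus `a` times the next, so it vanishes with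
  -- them.
  quotient-zeros : ∀ a g → Zeros (quotient a g) → eval g a ≈ 0# × Zeros g
  quotient-zeros a []      []         = refl , []
  quotient-zeros a (d ∷ g) (w≈0 ∷ q≈0) with quotient-zeros a g q≈0
  ... | v≈0 , g≈0 = w≈0 , d≈0 ∷ g≈0
    where
    d≈0 : d ≈ 0#
    d≈0 = begin
      d                 ≈⟨ +-identityʳ d ⟨
      d + 0#            ≈⟨ +-congˡ (zeroʳ a) ⟨
      d + a * 0#        ≈⟨ +-congˡ (*-congˡ v≈0) ⟨
      d + a * eval g a  ≈⟨ w≈0 ⟩
      0#                ∎

  -- Division by `x - a` at the first root leaves a quotient one entry shorter, which vanishes at
  -- the other roots because they are apart from `a`. The bound is on the length of the list, since
  -- the degree need not be decidable in a Heyting field.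
  zeros-by-roots : ∀ as f → AllPairs _#_ as → length f ≤ length as →
                   All (λ a → eval f a ≈ 0#) as → Zeros f
  zeros-by-roots _        []      _             _         _              = []
  zeros-by-roots (a ∷ as) (c ∷ g) (a#as ∷ as#) (s≤s g≤as) (fa≈0 ∷ fas≈0) =
    c≈0 ∷ proj₂ g-zero
    where
    quotient-root : ∀ {b} → a # b × eval (c ∷ g) b ≈ 0# → eval (quotient a g) b ≈ 0#
    quotient-root {b} (a#b , fb≈0) = invertible-cancelˡ (#-sym a#b) (begin
      (b - a) * eval (quotient a g) b                    ≈⟨ +-identityˡ _ ⟨
      0# + (b - a) * eval (quotient a g) b               ≈⟨ +-congʳ fa≈0 ⟨
      eval (c ∷ g) a + (b - a) * eval (quotient a g) b   ≈⟨ eval-quotient a b c g ⟨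
      eval (c ∷ g) b                                     ≈⟨ fb≈0 ⟩
      0#                                                 ∎)

    g-zero : eval g a ≈ 0# × Zeros g
    g-zero = quotient-zeros a g (zeros-by-roots as (quotient a g) as#
      (≡.subst (_≤ length as) (≡.sym (length-quotient a g)) g≤as)
      (All.zipWith quotient-root (a#as , fas≈0)))

    c≈0 : c ≈ 0#
    c≈0 = begin
      c                 ≈⟨ +-identityʳ c ⟨
      c + 0#            ≈⟨ +-congˡ (zeroʳ a) ⟨
      c + a * 0#        ≈⟨ +-congˡ (*-congˡ (proj₁ g-zero)) ⟨
      c + a * eval g a  ≈⟨ fa≈0 ⟩
      0#                ∎

  -- Monic polynomials with prescribed roots, and pairwise apart elements.

  linear : Carrier → Poly
  linear a = - a ∷ 1# ∷ []

  eval-linear : ∀ a x → eval (linear a) x ≈ x - a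
  eval-linear a x = begin
    - a + x * eval (const 1#) x  ≈⟨ +-congˡ (*-congˡ (eval-const 1# x)) ⟩
    - a + x * 1#                 ≈⟨ +-congˡ (*-identityʳ x) ⟩
    - a + x                      ≈⟨ +-comm _ x ⟩
    x - a                        ∎

  Monic : Poly → ℕ → Set ℓ₁
  Monic f n = coeff f n ≈ 1# × (∀ m → n < m → coeff f m ≈ 0#)

  coeff-linear-* : ∀ a f n →
    coeff (linear a *ₚ f) (suc n) ≈ - a * coeff f (suc n) + coeff f n
  coeff-linear-* a f n = begin
    coeff (map (- a *_) f +ₚ (0# ∷ g)) (suc n)
      ≈⟨ coeff-+ (map (- a *_) f) (0# ∷ g) (suc n) ⟩
    coeff (map (- a *_) f) (suc n) + coeff g n
      ≈⟨ +-cong (coeff-scale (- a) f (suc n)) (coeff-+ (map (1# *_) f) (const 0#) n) ⟩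
    - a * coeff f (suc n) + (coeff (map (1# *_) f) n + coeff (const 0#) n)
      ≈⟨ +-congˡ (+-cong (trans (coeff-scale 1# f n) (*-identityˡ _)) (coeff-const0 n)) ⟩
    - a * coeff f (suc n) + (coeff f n + 0#)
      ≈⟨ +-congˡ (+-identityʳ _) ⟩
    - a * coeff f (suc n) + coeff f n ∎
    where
    -- The unfolded product `const 1# *ₚ f`: beyond its last coefficient `1#` the recursion leaves
    -- one extra `0# ∷ []`.
    g = map (1# *_) f +ₚ const 0#
    coeff-const0 : ∀ m → coeff (const 0#) m ≈ 0#
    coeff-const0 zero    = refl
    coeff-const0 (suc m) = refl

  monic-linear-* : ∀ a f n → Monic f n → Monic (linear a *ₚ f) (suc n)
  monic-linear-* a f n (lead , above) = step (above (suc n) ℕ.≤-refl) lead ,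
    λ { (suc m) (s<s n<m) → step (above (suc m) (ℕ.m<n⇒m<1+n n<m)) (above m n<m) }
    where
    step : ∀ {m d} → coeff f (suc m) ≈ 0# → coeff f m ≈ d →
           coeff (linear a *ₚ f) (suc m) ≈ d
    step {m} {d} f₁₊ₘ≈0 fₘ≈d = begin
      coeff (linear a *ₚ f) (suc m)       ≈⟨ coeff-linear-* a f m ⟩
      - a * coeff f (suc m) + coeff f m   ≈⟨ +-cong (trans (*-congˡ f₁₊ₘ≈0) (zeroʳ _)) fₘ≈d ⟩
      0# + d                              ≈⟨ +-identityˡ d ⟩
      d                                   ∎

  withRoots : List Carrier → Poly
  withRoots []       = const 1#
  withRoots (a ∷ as) = linear a *ₚ withRoots as

  withRoots-monic : ∀ as → Monic (withRoots as) (length as)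
  withRoots-monic []       = refl , λ { (suc m) _ → refl }
  withRoots-monic (a ∷ as) =
    monic-linear-* a (withRoots as) (length as) (withRoots-monic as)

  eval-withRoots : ∀ a as x →
    eval (withRoots (a ∷ as)) x ≈ (x - a) * eval (withRoots as) x
  eval-withRoots a as x =
    trans (eval-* x (linear a) (withRoots as)) (*-congʳ (eval-linear a x))

  -- Every factor of an invertible product is invertible, and an invertible difference is an
  -- apartness. The inverse `u` is a parameter because the recursive call absorbs the factor `x - a`
  -- into it.
  withRoots-apart : ∀ as x u → u * eval (withRoots as) x ≈ 1# → All (x #_) as
  withRoots-apart []       x u _   = []
  withRoots-apart (a ∷ as) x u inv =
    invertibleˡ⇒# (u * w , trans (solve 3 (λ u w s → (u :* w) :* s := u :* (s :* w))
                                   refl u w (x - a)) inv′) ∷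
    withRoots-apart as x (u * (x - a)) (trans (*-assoc u _ w) inv′)
    where
    w = eval (withRoots as) x
    inv′ : u * ((x - a) * w) ≈ 1#
    inv′ = trans (*-congˡ (sym (eval-withRoots a as x))) inv

  -- At a root of `withRoots as +ₚ const 1#` the product has value -1, which is its own inverse.
  apart-from-all : AlgebraicallyClosed K → ∀ as → ∃[ x ] All (x #_) as
  -- Without roots the polynomial would be the constant `1# + 1#`, to which algebraic closedness
  -- does not apply.
  apart-from-all closed []         = 0# , []
  apart-from-all closed as@(a ∷ bs) = x , withRoots-apart as x (- 1#) (begin
    - 1# * w                      ≈⟨ +-identityʳ _ ⟨
    - 1# * w + 0#                 ≈⟨ +-congˡ root′ ⟨
    - 1# * w + (w + 1#)           ≈⟨ +-congˡ (+-congʳ (*-identityˡ w)) ⟨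
    - 1# * w + (1# * w + 1#)      ≈⟨ solve 3 (λ n o w → n :* w :+ (o :* w :+ o) := (n :+ o) :* w :+ o)
                                       refl (- 1#) 1# w ⟩
    (- 1# + 1#) * w + 1#          ≈⟨ +-congʳ (trans (*-congʳ (-‿inverseˡ 1#)) (zeroˡ w)) ⟩
    0# + 1#                       ≈⟨ +-identityˡ 1# ⟩
    1#                            ∎)
    where
    f = withRoots as
    coeff-f+1 : ∀ n → coeff (f +ₚ const 1#) (suc n) ≈ coeff f (suc n)
    coeff-f+1 n = trans (coeff-+ f (const 1#) (suc n)) (+-identityʳ _)

    -- The added `1#` changes only the constant coefficient, while the leading one has positive
    -- index.
    f+1-degree : HasDegree K (f +ₚ const 1#) (suc (length bs))
    f+1-degree with withRoots-monic as
    ... | lead , above =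
      #-congʳ (sym (trans (coeff-f+1 (length bs)) lead)) 1#0 ,
      λ { (suc m) n<m → trans (coeff-f+1 m) (above (suc m) n<m) }

    x = proj₁ (closed (f +ₚ const 1#) (length bs) f+1-degree)
    w = eval f x

    root′ : w + 1# ≈ 0#
    root′ = begin
      w + 1#                    ≈⟨ +-congˡ (eval-const 1# x) ⟨
      w + eval (const 1#) x     ≈⟨ eval-+ x f (const 1#) ⟨
      eval (f +ₚ const 1#) x    ≈⟨ proj₂ (closed (f +ₚ const 1#) (length bs) f+1-degree) ⟩
      0#                        ∎

  -- A finite field has too few points to separate polynomials; an algebraically closed one has as
  -- many test points as any list has entries.
  apart-elements : AlgebraicallyClosed K → ∀ n →
                   ∃[ as ] AllPairs _#_ as × length as ≡ n
  apart-elements closed zero    = [] , [] , ≡.refl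
  apart-elements closed (suc n) with apart-elements closed n
  ... | as , as# , len with apart-from-all closed as
  ...   | x , x#as = x ∷ as , x#as ∷ as# , ≡.cong suc len

  -- Polynomials determined by their values.

  coeff-zeros : ∀ f → Zeros f → ∀ n → coeff f n ≈ 0#
  coeff-zeros []      []          n       = refl
  coeff-zeros (a ∷ f) (a≈0 ∷ f≈0) zero    = a≈0
  coeff-zeros (a ∷ f) (a≈0 ∷ f≈0) (suc n) = coeff-zeros f f≈0 n

  module _ (closed : AlgebraicallyClosed K)
           {a ℓ} (R : RawRing a ℓ) {φ : RawRing.Carrier R → Carrier}
           (φ-homo : IsRingHomomorphism R rawRing φ) where
    private
      module R = RawRing R
      module R[x] = Polynomials R
      module EvalR = Evaluation R (commutativeRing K) φ-homo
    open IsRingHomomorphism φ-homo using (0#-homo)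

    coeff-map : ∀ f n → coeff (map φ f) n ≈ φ (R[x].coeff f n)
    coeff-map []      n       = sym 0#-homo
    coeff-map (a ∷ f) zero    = refl
    coeff-map (a ∷ f) (suc n) = coeff-map f n

    eval-map : ∀ f s → eval (map φ f) s ≈ EvalR.eval f s
    eval-map []      s = refl
    eval-map (a ∷ f) s = +-congˡ (*-congˡ (eval-map f s))

    -- The test points are as many as the entries of the mapped list. The conclusion stays at images
    -- under `φ`, which is not assumed injective: it may be the evaluation of `F[x]` at a point.
    values-zero⇒coeffs-zero : ∀ f → (∀ s → EvalR.eval f s ≈ 0#) →
                              ∀ n → φ (R[x].coeff f n) ≈ 0#
    values-zero⇒coeffs-zero f f≈0 n with apart-elements closed (length (map φ f))
    ... | as , as# , len = trans (sym (coeff-map f n))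
      (coeff-zeros (map φ f)
        (zeros-by-roots as (map φ f) as# (ℕ.≤-reflexive (≡.sym len))
          (All.universal (λ s → trans (eval-map f s) (f≈0 s)) as)) n)

    values-determine-coeffs : ∀ f g → (∀ s → EvalR.eval f s ≈ EvalR.eval g s) →
                              ∀ n → φ (R[x].coeff f n) ≈ φ (R[x].coeff g n)
    values-determine-coeffs f g f≈g n = x∙y⁻¹≈ε⇒x≈y _ _ (begin
      φ (R[x].coeff f n) - φ (R[x].coeff g n)
        ≈⟨ +-congˡ (EvalR.coeff-neg g n) ⟨
      φ (R[x].coeff f n) + φ (R[x].coeff (map R.-_ g) n)
        ≈⟨ EvalR.coeff-+ f (map R.-_ g) n ⟨
      φ (R[x].coeff (f R[x].+ₚ map R.-_ g) n)
        ≈⟨ values-zero⇒coeffs-zero (f R[x].+ₚ map R.-_ g) difference≈0 n ⟩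
      0# ∎)
      where
      difference≈0 : ∀ s → EvalR.eval (f R[x].+ₚ map R.-_ g) s ≈ 0#
      difference≈0 s = begin
        EvalR.eval (f R[x].+ₚ map R.-_ g) s          ≈⟨ EvalR.eval-+ s f (map R.-_ g) ⟩
        EvalR.eval f s + EvalR.eval (map R.-_ g) s   ≈⟨ +-cong (f≈g s) (EvalR.eval-neg s g) ⟩
        EvalR.eval g s - EvalR.eval g s              ≈⟨ -‿inverseʳ _ ⟩
        0#                                           ∎

-- Values of bivariate polynomials in the algebraic closure.

module ClosureValues {c ℓ₁ ℓ₂ c′ ℓ₁′ ℓ₂′} {F : HeytingField c ℓ₁ ℓ₂}
                     (F̄ : AlgebraicClosure F c′ ℓ₁′ ℓ₂′) where
  open AlgebraicClosure F̄
  open IsRingMonomorphism isRingMonomorphism using (isRingHomomorphism; injective)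

  K : CommutativeRing c′ ℓ₁′
  K = commutativeRing closure

  open CommutativeRing K using (Carrier; _≈_; _+_; rawRing; trans)
  open HeytingFieldPolynomials closure using (values-determine-coeffs)
  open Polynomials (fieldRing F) using (Poly; coeff; evalIn; const; X)
  private
    module F[x][y] = Polynomials (fieldRing F [X])
    module Eval = Evaluation (fieldRing F) K isRingHomomorphism

  value : Carrier → Poly → Carrier
  value a f = evalIn rawRing embed f a

  value-homo : ∀ a → IsRingHomomorphism (fieldRing F [X]) rawRing (value a)
  value-homo = Eval.eval-isRingHomomorphism

  private
    module Eval₂ a = Evaluation (fieldRing F [X]) K (value-homo a)

  value₂ : Carrier → Carrier → F[x][y].Poly → Carrier
  value₂ a b g = F[x][y].evalIn rawRing (value a) g b

  value₂-homo : ∀ a b → IsRingHomomorphism (fieldRing F [X] [X]) rawRing (value₂ a b)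
  value₂-homo a = Eval₂.eval-isRingHomomorphism a

  value₂-const : ∀ a b f → value₂ a b (F[x][y].const f) ≈ value a f
  value₂-const a b f = Eval₂.eval-const a f b

  value₂-x : ∀ a b → value₂ a b (F[x][y].const X) ≈ a
  value₂-x a b = trans (value₂-const a b X) (Eval.eval-X a)

  value₂-y : ∀ a b → value₂ a b F[x][y].X ≈ b
  value₂-y a b = Eval₂.eval-X a b

  -- Evaluation at `(a , b)` is a ring homomorphism that acts on constants as `embed`, so it passes
  -- through the substitution of `g`. The instances used are `g` = x, y and x + y.
  value₂-substitute : ∀ a b f {g s} → value₂ a b g ≈ s →
    value₂ a b (evalIn (fieldRing F [X] [X]) (F[x][y].const ∘ const) f g) ≈ value s f
  value₂-substitute a b f = evalIn-homo (fieldRing F)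
    (λ r → trans (value₂-const a b (const r)) (Eval.eval-const r a)) f
    where open HomomorphismProperties (fieldRing F [X] [X]) K (value₂-homo a b)

  -- Two passes: with `a` fixed, varying `b` equates the values at `a` of the coefficients of each
  -- power of y; varying `a` then equates the images of their own coefficients, and injectivity of
  -- `embed` returns to `F`.
  values₂-determine : ∀ g h → (∀ a b → value₂ a b g ≈ value₂ a b h) →
                      RawRing._≈_ (fieldRing F [X] [X]) g h
  values₂-determine g h g≈h n m = injective
    (values-determine-coeffs algebraicallyClosed (fieldRing F) isRingHomomorphism
      (F[x][y].coeff g n) (F[x][y].coeff h n)
      (λ a → values-determine-coeffs algebraicallyClosed (fieldRing F [X]) (value-homo a)
        g h (g≈h a) n) m)

-- Null sequences and vanishing binomial coefficients.

module NullSeries {c ℓ₁ ℓ₂ c′ ℓ₁′ ℓ₂′} {F : HeytingField c ℓ₁ ℓ₂}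
  (F̄ : AlgebraicClosure F c′ ℓ₁′ ℓ₂′) where
  open Polynomials (fieldRing F) using (Poly)
  open DividedSeries (fieldRing F [X])
  open DividedElements (fieldRing F [X])
  open RawRing (fieldRing F [X]) using ()
    renaming (_+_ to _+ᴾ_; _*_ to _*ᴾ_; 1# to 1ᴾ; 0# to 0ᴾ)
  open RingOps (fieldRing F [X]) using () renaming (sum to sumᴾ; _×ᴿ_ to _×ᴾ_)
  open ClosureValues F̄
  open CommutativeRing K hiding (zero)
  open SumProperties K
  open SemiringMult semiring using (×-congʳ; ×-congˡ; ×-homo-1; ×-assoc-*)
    renaming (_×_ to _×ᴷ_)
  open HeytingProperties (HeytingField.heytingCommutativeRing (AlgebraicClosure.closure F̄))
    using (1#0)
  open SetoidReasoning setoid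
  open HomomorphismProperties (fieldRing F [X]) K
  private
    module V a = IsRingHomomorphism (value-homo a)

  1≉0 : ¬ (1# ≈ 0#)
  1≉0 1≈0 = HeytingField.#-irrefl (AlgebraicClosure.closure F̄) 1≈0 1#0

  ×-zero : ∀ n {x} → x ≈ 0# → n ×ᴷ x ≈ 0#
  ×-zero zero    x≈0 = refl
  ×-zero (suc n) x≈0 = trans (+-cong x≈0 (×-zero n x≈0)) (+-identityˡ 0#)

  module _ (i : ℕ → ℕ) (null : NullSequence i) where

    -- In the coefficient of index `i j + i t` of the vanishing product, every summand except the
    -- one at `i j` is zero, and that one is the binomial coefficient.
    null⇒C×1≈0 : ∀ j t → ((i j +ℕ i t) C i j) ×ᴷ 1# ≈ 0#
    null⇒C×1≈0 j t = begin
      (n C i j) ×ᴷ 1#                      ≈⟨ term-i ⟨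
      v (term k₀)                          ≈⟨ sum-single (v ∘ term) k₀ term-off ⟨
      sum (v ∘ term)                       ≈⟨ sum-homo (value-homo 0#) term ⟨
      v (sumᴾ term)                        ≈⟨ V.⟦⟧-cong 0# {sumᴾ term} {0ᴾ} (null j t n) ⟩
      0#                                   ∎
      where
      n = i j +ℕ i t
      -- All coefficients here are constant polynomials, so any evaluation point serves.
      v = value 0#
      term : Vector Poly (suc n)
      term k = (n C toℕ k) ×ᴾ (𝔇 (i j) (toℕ k) *ᴾ 𝔇 (i t) (n ∸ toℕ k))

      v-term : ∀ k → v (term k) ≈
        (n C toℕ k) ×ᴷ (v (𝔇 (i j) (toℕ k)) * v (𝔇 (i t) (n ∸ toℕ k)))
      v-term k = trans (×-homo (value-homo 0#) (n C toℕ k) _)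
        (×-congʳ (n C toℕ k) (V.*-homo 0# (𝔇 (i j) (toℕ k)) _))

      ij<1+n : i j < suc n
      ij<1+n = s≤s (ℕ.m≤m+n (i j) (i t))

      k₀ : Fin (suc n)
      k₀ = fromℕ< ij<1+n

      term-i : v (term k₀) ≈ (n C i j) ×ᴷ 1#
      term-i = begin
        v (term k₀)   ≈⟨ v-term k₀ ⟩
        (n C toℕ k₀) ×ᴷ (v (𝔇 (i j) (toℕ k₀)) * v (𝔇 (i t) (n ∸ toℕ k₀)))
          ≡⟨ ≡.cong (λ k → (n C k) ×ᴷ (v (𝔇 (i j) k) * v (𝔇 (i t) (n ∸ k))))
               (Fin.toℕ-fromℕ< ij<1+n) ⟩
        (n C i j) ×ᴷ (v (𝔇 (i j) (i j)) * v (𝔇 (i t) (n ∸ i j)))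
          ≡⟨ ≡.cong (λ k → (n C i j) ×ᴷ (v (𝔇 (i j) (i j)) * v (𝔇 (i t) k)))
               (ℕ.m+n∸m≡n (i j) (i t)) ⟩
        (n C i j) ×ᴷ (v (𝔇 (i j) (i j)) * v (𝔇 (i t) (i t)))
          ≡⟨ ≡.cong₂ (λ f g → (n C i j) ×ᴷ (v f * v g))
               (𝔇-diagonal (i j)) (𝔇-diagonal (i t)) ⟩
        (n C i j) ×ᴷ (v 1ᴾ * v 1ᴾ)
          ≈⟨ ×-congʳ (n C i j) (trans (*-cong (V.1#-homo 0#) (V.1#-homo 0#)) (*-identityˡ 1#)) ⟩
        (n C i j) ×ᴷ 1# ∎

      term-off : ∀ k → k ≢ k₀ → v (term k) ≈ 0#
      term-off k k≢k₀ = trans (v-term k) (×-zero (n C toℕ k)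
        (trans (*-congʳ (reflexive (≡.cong v (𝔇-offDiagonal ij≢k)))) (zeroˡ _)))
        where
        ij≢k : i j ≢ toℕ k
        ij≢k ij≡k = k≢k₀ (Fin.toℕ-injective
          (≡.trans (≡.sym ij≡k) (≡.sym (Fin.toℕ-fromℕ< ij<1+n))))

    C×1≈0 : ∀ {n k} → k ≤ n → ∀ j t → i j ≡ k → i t ≡ n ∸ k → (n C k) ×ᴷ 1# ≈ 0#
    C×1≈0 {n} {k} k≤n j t ij≡k it≡n∸k = trans
      (reflexive (≡.cong₂ (λ m l → (m C l) ×ᴷ 1#)
        (≡.sym (≡.trans (≡.cong₂ _+ℕ_ ij≡k it≡n∸k) (ℕ.m+[n∸m]≡n k≤n))) (≡.sym ij≡k)))
      (null⇒C×1≈0 j t)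

    0∉null : ∀ j → i j ≢ 0
    0∉null j ij≡0 = 1≉0 (trans (sym (+-identityʳ 1#)) (C×1≈0 z≤n j j ij≡0 ij≡0))

    -- Additivity of the coefficients and the Binomial Theorem.

    module _ (e : ℕ → Poly) (additive : ∀ j → Additive F̄ (e j))
             (summable : Summable (λ j → e j • 𝔇 (i j))) where

      tail-sum : ℕ → Poly
      tail-sum = ∑ (λ j → e j • 𝔇 (i j)) summable

      summand-zero : ∀ a j n → i j ≢ n → value a ((e j • 𝔇 (i j)) n) ≈ 0#
      summand-zero a j n ij≢n = begin
        value a (e j *ᴾ 𝔇 (i j) n)             ≈⟨ V.*-homo a (e j) _ ⟩
        value a (e j) * value a (𝔇 (i j) n)
          ≡⟨ ≡.cong (λ f → value a (e j) * value a f) (𝔇-offDiagonal ij≢n) ⟩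
        value a (e j) * 0#                     ≈⟨ zeroʳ _ ⟩
        0#                                     ∎

      value-tail-sum : ∀ a n → value a (tail-sum n) ≈
        sum {proj₁ (summable n)} (λ j → value a ((e (toℕ j) • 𝔇 (i (toℕ j))) n))
      value-tail-sum a n = sum-homo (value-homo a) {proj₁ (summable n)}
        λ j → (e (toℕ j) • 𝔇 (i (toℕ j))) n

      -- Only the finitely many `j` below the bound given by `summable n` are searched; if none of
      -- them hits `n`, every summand is zero.
      tail-sum-zero-or-hit : ∀ n → (∀ a → value a (tail-sum n) ≈ 0#) ⊎ ∃[ j ] i j ≡ n
      tail-sum-zero-or-hit n with Fin.any? {n = proj₁ (summable n)} (λ j → i (toℕ j) ℕ.≟ n)
      ... | yes (j , ij≡n) = inj₂ (toℕ j , ij≡n)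
      ... | no miss        = inj₁ λ a → trans (value-tail-sum a n)
        (sum-zero λ j → summand-zero a (toℕ j) n λ ij≡n → miss (j , ij≡n))

      tail-sum-zero : ∀ a → value a (tail-sum 0) ≈ 0#
      tail-sum-zero a with tail-sum-zero-or-hit 0
      ... | inj₁ zero-sum   = zero-sum a
      ... | inj₂ (j , ij≡0) = contradiction ij≡0 (0∉null j)

      -- An index may occur several times in `i`, so several `e j` can meet in one coefficient;
      -- additivity passes to their sum.
      tail-sum-additive : ∀ n a b →
        value (a + b) (tail-sum n) ≈ value a (tail-sum n) + value b (tail-sum n)
      tail-sum-additive n a b = begin
        value (a + b) (tail-sum n)             ≈⟨ value-tail-sum (a + b) n ⟩
        sum (λ j → value (a + b) (s j))        ≈⟨ sum-cong-≋ {proj₁ (summable n)} (λ j → s-additive (toℕ j)) ⟩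
        sum (λ j → value a (s j) + value b (s j))
          ≈⟨ ∑-distrib-+ (value a ∘ s) (value b ∘ s) ⟩
        sum (value a ∘ s) + sum (value b ∘ s)
          ≈⟨ +-cong (value-tail-sum a n) (value-tail-sum b n) ⟨
        value a (tail-sum n) + value b (tail-sum n) ∎
        where
        s : Vector Poly (proj₁ (summable n))
        s j = (e (toℕ j) • 𝔇 (i (toℕ j))) n

        s-additive : ∀ j → value (a + b) ((e j • 𝔇 (i j)) n) ≈
                     value a ((e j • 𝔇 (i j)) n) + value b ((e j • 𝔇 (i j)) n)
        s-additive j with i j ℕ.≟ n
        ... | yes _ = begin
          value (a + b) (e j *ᴾ 1ᴾ)               ≈⟨ *1 (a + b) ⟩
          value (a + b) (e j)                     ≈⟨ additive j a b ⟩
          value a (e j) + value b (e j)           ≈⟨ +-cong (*1 a) (*1 b) ⟨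
          value a (e j *ᴾ 1ᴾ) + value b (e j *ᴾ 1ᴾ) ∎
          where
          *1 : ∀ d → value d (e j *ᴾ 1ᴾ) ≈ value d (e j)
          *1 d = trans (V.*-homo d (e j) 1ᴾ) (trans (*-congˡ (V.1#-homo d)) (*-identityʳ _))
        ... | no _ = trans (*0 (a + b)) (sym (trans (+-cong (*0 a) (*0 b)) (+-identityˡ 0#)))
          where
          *0 : ∀ d → value d (e j *ᴾ 0ᴾ) ≈ 0#
          *0 d = trans (V.*-homo d (e j) 0ᴾ) (zeroʳ _)

      C×product≈0 : ∀ {n k} → k ≤ n → ∀ a b →
        (n C k) ×ᴷ (value a (tail-sum k) * value b (tail-sum (n ∸ k))) ≈ 0#
      C×product≈0 {n} {k} k≤n a b with tail-sum-zero-or-hit k | tail-sum-zero-or-hit (n ∸ k)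
      ... | inj₁ zero-sum   | _ =
        ×-zero (n C k) (trans (*-congʳ (zero-sum a)) (zeroˡ _))
      ... | inj₂ _          | inj₁ zero-sum =
        ×-zero (n C k) (trans (*-congˡ (zero-sum b)) (zeroʳ _))
      ... | inj₂ (j , ij≡k) | inj₂ (t , it≡n∸k) = begin
        -- The multiple is moved onto `1#`, where nullity makes it vanish.
        (n C k) ×ᴷ w           ≈⟨ ×-congʳ (n C k) (*-identityˡ w) ⟨
        (n C k) ×ᴷ (1# * w)    ≈⟨ ×-assoc-* (n C k) 1# w ⟨
        ((n C k) ×ᴷ 1#) * w    ≈⟨ *-congʳ (C×1≈0 k≤n j t ij≡k it≡n∸k) ⟩
        0# * w                 ≈⟨ zeroˡ w ⟩
        0#                     ∎
        where w = value a (tail-sum k) * value b (tail-sum (n ∸ k))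

      f : ℕ → Poly
      f = 𝔣 i e summable

      value-f₀ : ∀ a → value a (f 0) ≈ 1#
      value-f₀ a = begin
        value a (1ᴾ +ᴾ tail-sum 0)             ≈⟨ V.+-homo a 1ᴾ (tail-sum 0) ⟩
        value a 1ᴾ + value a (tail-sum 0)      ≈⟨ +-cong (V.1#-homo a) (tail-sum-zero a) ⟩
        1# + 0#                                ≈⟨ +-identityʳ 1# ⟩
        1#                                     ∎

      -- For positive `n` the coefficient of `𝔇 0` computes to the empty list, and `[] +ₚ g`
      -- computes to `g`.
      value-f : ∀ a n → 0 < n → value a (f n) ≡ value a (tail-sum n)
      value-f a (suc n) _ = ≡.refl

      binomial-values : ∀ n a b → value (a + b) (f n) ≈
        sum {suc n} (λ k → (n C toℕ k) ×ᴷ (value a (f (toℕ k)) * value b (f (n ∸ toℕ k))))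
      binomial-values zero a b = begin
        value (a + b) (f 0)                            ≈⟨ value-f₀ (a + b) ⟩
        1#                                             ≈⟨ *-identityˡ 1# ⟨
        1# * 1#                                        ≈⟨ *-cong (value-f₀ a) (value-f₀ b) ⟨
        -- The multiple by `0 C 0` unfolds to `w + 0#`, and the sum with one term appends a second
        -- `0#`.
        value a (f 0) * value b (f 0)                  ≈⟨ +-identityʳ _ ⟨
        value a (f 0) * value b (f 0) + 0#             ≈⟨ +-identityʳ _ ⟨
        value a (f 0) * value b (f 0) + 0# + 0#        ∎
      binomial-values n@(suc m) a b = begin
        value (a + b) (f n)                            ≈⟨ tail-sum-additive n a b ⟩
        -- The term with k = 0 yields the value at `b` and the term with k = n the value at `a`,
        -- hence the swap.
        value a (f n) + value b (f n)                  ≈⟨ +-comm _ _ ⟩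
        value b (f n) + value a (f n)                  ≈⟨ +-cong first last ⟨
        term 0 + term (suc (toℕ (fromℕ m)))            ≈⟨ sum-ends (term ∘ toℕ) middle ⟨
        sum {suc n} (term ∘ toℕ)                       ∎
        where
        term : ℕ → Carrier
        term k = (n C k) ×ᴷ (value a (f k) * value b (f (n ∸ k)))

        first : term 0 ≈ value b (f n)
        first = begin
          (n C 0) ×ᴷ (value a (f 0) * value b (f n))   ≈⟨ ×-congˡ (nC0≡1 n) ⟩
          1 ×ᴷ (value a (f 0) * value b (f n))         ≈⟨ ×-homo-1 _ ⟩
          value a (f 0) * value b (f n)                ≈⟨ *-congʳ (value-f₀ a) ⟩
          1# * value b (f n)                           ≈⟨ *-identityˡ _ ⟩
          value b (f n)                                ∎

        last : term (suc (toℕ (fromℕ m))) ≈ value a (f n)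
        last = begin
          term (suc (toℕ (fromℕ m)))                   ≡⟨ ≡.cong (term ∘ suc) (Fin.toℕ-fromℕ m) ⟩
          (n C n) ×ᴷ (value a (f n) * value b (f (n ∸ n)))  ≈⟨ ×-congˡ (nCn≡1 n) ⟩
          1 ×ᴷ (value a (f n) * value b (f (n ∸ n)))   ≈⟨ ×-homo-1 _ ⟩
          value a (f n) * value b (f (n ∸ n))
            ≡⟨ ≡.cong (λ k → value a (f n) * value b (f k)) (ℕ.n∸n≡0 n) ⟩
          value a (f n) * value b (f 0)                ≈⟨ *-congˡ (value-f₀ b) ⟩
          value a (f n) * 1#                           ≈⟨ *-identityʳ _ ⟩
          value a (f n)                                ∎

        middle : ∀ (k : Fin m) → term (suc (toℕ (inject₁ k))) ≈ 0#
        middle k = begin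
          term (suc (toℕ (inject₁ k)))                 ≡⟨ ≡.cong (term ∘ suc) (Fin.toℕ-inject₁ k) ⟩
          term l
            ≡⟨ ≡.cong (λ w → (n C l) ×ᴷ (value a (f l) * w))
                 (value-f b (n ∸ l) (ℕ.m<n⇒0<n∸m l<n)) ⟩
          (n C l) ×ᴷ (value a (tail-sum l) * value b (tail-sum (n ∸ l)))
            ≈⟨ C×product≈0 (ℕ.<⇒≤ l<n) a b ⟩
          0#                                           ∎
          where
          -- `l` runs from 1 to `m`, so `l` and `n ∸ l` are both positive and `f` agrees with
          -- `tail-sum` at both.
          l = suc (toℕ k)
          l<n : l < n
          l<n = s<s (Fin.toℕ<n k)

      open Binomial (fieldRing F)

      -- Evaluation at `(a , b)` carries both sides of the polynomial identity to the two sides of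
      -- `binomial-values`.
      binomialTheorem : SatisfiesBinomialTheorem f
      binomialTheorem n = values₂-determine (f n ⟨ x +₂ y ⟩) (sum₂ term) λ a b →
        let module V₂ = IsRingHomomorphism (value₂-homo a b)
            module H₂ = HomomorphismProperties (fieldRing F [X] [X]) K (value₂-homo a b)
            v = value₂ a b in begin
        v (f n ⟨ x +₂ y ⟩)
          ≈⟨ value₂-substitute a b (f n)
               (trans (V₂.+-homo x y) (+-cong (value₂-x a b) (value₂-y a b))) ⟩
        value (a + b) (f n)
          ≈⟨ binomial-values n a b ⟩
        sum {suc n} (λ k → (n C toℕ k) ×ᴷ (value a (f (toℕ k)) * value b (f (n ∸ toℕ k))))
          ≈⟨ sum-cong-≋ {suc n} (λ k → trans
               (H₂.×-homo (n C toℕ k) ((f (toℕ k) ⟨ x ⟩) *₂ (f (n ∸ toℕ k) ⟨ y ⟩)))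
               (×-congʳ (n C toℕ k) (trans
                 (V₂.*-homo (f (toℕ k) ⟨ x ⟩) (f (n ∸ toℕ k) ⟨ y ⟩))
                 (*-cong (value₂-substitute a b (f (toℕ k)) (value₂-x a b))
                         (value₂-substitute a b (f (n ∸ toℕ k)) (value₂-y a b)))))) ⟨
        sum (v ∘ term)
          ≈⟨ H₂.sum-homo term ⟨
        v (sum₂ term) ∎
        where
        module R₁ = Polynomials (fieldRing F)
        module R₂ = Polynomials (fieldRing F [X])
        open RawRing (fieldRing F [X] [X]) using () renaming (_+_ to _+₂_; _*_ to _*₂_)
        open RingOps (fieldRing F [X] [X]) using () renaming (sum to sum₂; _×ᴿ_ to _×₂_)
        x y : R₂.Poly
        x = R₂.const R₁.X
        y = R₂.X
        _⟨_⟩ : Poly → R₂.Poly → R₂.Poly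
        _⟨_⟩ = R₁.evalIn (fieldRing F [X] [X]) (R₂.const ∘ R₁.const)
        term : Vector R₂.Poly (suc n)
        term k = (n C toℕ k) ×₂ ((f (toℕ k) ⟨ x ⟩) *₂ (f (n ∸ toℕ k) ⟨ y ⟩))

      nontrivial : Nontrivial f
      -- Index 0 is enough, since `f 0` has value `1#` at every point.
      nontrivial f≈0 = 1≉0 (trans (sym (value-f₀ 0#)) (V.⟦⟧-cong 0# {f 0} {0ᴾ} (f≈0 0)))

      f∈𝔅𝔇* : 𝔅𝔇* f
      f∈𝔅𝔇* = f , binomialTheorem , nontrivial , λ _ _ → CommutativeRing.refl (commutativeRing F)

proposition6 : ∀ {c ℓ₁ ℓ₂ c′ ℓ₁′ ℓ₂′}
    (F : HeytingField c ℓ₁ ℓ₂) (F̄ : AlgebraicClosure F c′ ℓ₁′ ℓ₂′)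
    (p : ℕ) → 0 < p → HasCharacteristic (fieldRing F) p →
    let open Polynomials (fieldRing F) using (Poly)
        open DividedSeries (fieldRing F [X])
        open Binomial (fieldRing F) using (𝔅𝔇*)
    in
    (i : ℕ → ℕ) → NullSequence i →
    (e : ℕ → Poly) → (∀ j → Additive F̄ (e j)) →
    (summable : Summable (λ j → e j • 𝔇 (i j))) →
    𝔅𝔇* (𝔣 i e summable)
proposition6 F F̄ p 0<p charF i null e additive summable =
  NullSeries.f∈𝔅𝔇* F̄ i null e additive summable
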